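{- Let $G$ be a chordless graph and $M$ a matching in $G$. Then every subgraph $H$ of $G_M$ with at least two vertices contains at least two vertices of degree at most $2$ in $H$.
   Context: All graphs are finite, simple and undirected. A graph is chordless if no cycle of it has a chord. For a matching $M$ in $G$, $G[M]$ is the subgraph of $G$ induced by the endpoints of edges of $M$, and $G_M$ is the simple graph obtained from $G[M]$ by contracting each edge $e\in M$ to a vertex $v_e$ and removing parallel edges (so $v_ev_f\in E(G_M)$ iff some edge of $G$ joins an endpoint of $e$ to an endpoint of $f$). -}

module Defs where

open import Data.Nat using (ℕ; zero; suc; _+_; _≤_; _<?_)
open import Data.Fin using (Fin; zero; suc; toℕ; fromℕ<)
open import Data.Bool using (Bool; true; false; if_then_else_)
open import Data.List using (List; map)
open import Data.Nat.ListAction using (sum)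
open import Data.List.Base using (allFin)
open import Data.Product using (Σ; _×_; ∃; ∃-syntax; _,_)
open import Relation.Binary.PropositionalEquality using (_≡_; _≢_)
open import Relation.Nullary using (¬_; yes; no)

record Graph (n : ℕ) : Set where
  field
    adj     : Fin n → Fin n → Bool
    adj-sym : ∀ u v → adj u v ≡ adj v u
    irrefl  : ∀ v → adj v v ≡ false
open Graph public

next : ∀ {k} → Fin (suc k) → Fin (suc k)
next {k} i with suc (toℕ i) <? suc k
... | yes p = fromℕ< p
... | no _  = zero

-- A cycle of length k+3 ≥ 3: distinct vertices c 0, …, c (k+2), with
-- consecutive ones (cyclically) adjacent.
record Cycle {n : ℕ} (G : Graph n) : Set where
  field
    len    : ℕ
    vtx    : Fin (suc (suc (suc len))) → Fin n
    inj    : ∀ i j → vtx i ≡ vtx j → i ≡ j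
    consec : ∀ i → adj G (vtx i) (vtx (next i)) ≡ true
open Cycle public

Chord : ∀ {n} {G : Graph n} → Cycle G → Set
Chord {G = G} C =
  Σ (Fin (suc (suc (suc (len C))))) λ i → Σ (Fin (suc (suc (suc (len C))))) λ j →
    (adj G (vtx C i) (vtx C j) ≡ true) × (j ≢ next i) × (i ≢ next j)

Chordless : ∀ {n} → Graph n → Set
Chordless G = ∀ (C : Cycle G) → ¬ Chord C

-- A matching with m edges, indexed by Fin m; edge e has endpoints
-- end e false and end e true.  All 2m endpoints are pairwise distinct.
record Matching {n : ℕ} (G : Graph n) : Set where
  field
    size     : ℕ
    end      : Fin size → Bool → Fin n
    isEdge   : ∀ e → adj G (end e false) (end e true) ≡ true
    disjoint : ∀ e f a b → end e a ≡ end f b → e ≡ f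
open Matching public

-- adjacency in the contracted graph G_M (vertices = edges of M)
GM-Adj : ∀ {n} {G : Graph n} (M : Matching G) → Fin (size M) → Fin (size M) → Set
GM-Adj {G = G} M e f = (e ≢ f) × ∃[ a ] ∃[ b ] (adj G (end M e a) (end M f b) ≡ true)

record SubgraphGM {n : ℕ} {G : Graph n} (M : Matching G) : Set where
  field
    inH     : Fin (size M) → Bool
    hadj    : Fin (size M) → Fin (size M) → Bool
    hsym    : ∀ e f → hadj e f ≡ hadj f e
    hsub    : ∀ e f → hadj e f ≡ true → GM-Adj M e f
    hvert   : ∀ e f → hadj e f ≡ true → inH e ≡ true
open SubgraphGM public

count : ∀ {m} → (Fin m → Bool) → ℕ
count {m} p = sum (map (λ x → if p x then 1 else 0) (allFin m))

degH : ∀ {n} {G : Graph n} {M : Matching G} → SubgraphGM M → Fin (size M) → ℕ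
degH H e = count (hadj H e)

{-# OPTIONS --safe #-}
module Submission where

-- Keep one edge of G for every edge of H.  Since every edge u v that is joined by two
-- further internally disjoint u–v paths is a chord, such configurations ("thetas") do
-- not occur.  Explore G depth first, always entering the M-mate b of a vertex a right
-- after a, before the other neighbours of a.  If no vertex of H in the subtree explored
-- from a pair (a , b) has degree at most 2, then the subtree has a rigid shape: b is a leaf
-- with a single back edge, and the subtree also reaches a vertex closer to the root than
-- the end of that back edge.  Two subtrees or back edges leaving the same vertex always
-- create a theta, which limits how shapes can be combined, and at the root there is no
-- room for the shape.  So from any root one finds a vertex of degree at most 2 other than
-- the root; doing this twice gives two of them.

open import Defs
open import Data.Bool using (Bool; true; false; not; if_then_else_)
import Data.Bool.Properties as Bool
open import Data.Empty using (⊥; ⊥-elim)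
open import Data.Fin using (Fin; zero; suc; toℕ; fromℕ<)
import Data.Fin.Properties as Fin
open import Data.List using (List; []; _∷_; _++_; length; lookup; map; filter; allFin)
open import Data.List.Membership.Propositional using (_∈_; _∉_; find; lose)
open import Data.List.Membership.Propositional.Properties using (∈-lookup; ∈-++⁺ˡ; ∈-filter⁺; ∈-filter⁻; ∈-allFin)
open import Data.List.Properties using (filter-notAll)
open import Data.List.Relation.Binary.Subset.Propositional using (_⊆_)
open import Data.List.Relation.Unary.All as All using (All; []; _∷_)
import Data.List.Relation.Unary.All.Properties as All
open import Data.List.Relation.Unary.AllPairs using ([]; _∷_)
open import Data.List.Relation.Unary.Any as Any using (here; there; any?)
open import Data.List.Relation.Unary.Any.Properties using (lookup-index)
open import Data.List.Relation.Unary.Linked using (Linked; []; [-]; _∷_)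
open import Data.List.Relation.Unary.Unique.Propositional using (Unique)
import Data.List.Relation.Unary.Unique.Propositional.Properties as Unique
open import Data.Nat using (ℕ; zero; suc; _≤_; _<_; _<?_; z≤n; s≤s)
open import Data.Nat.ListAction using (sum)
open import Data.Nat.Properties hiding (_≟_)
open import Data.Product using (_×_; ∃-syntax; _,_; proj₁; proj₂)
open import Data.Product.Properties using (≡-dec)
open import Data.Sum using (_⊎_; inj₁; inj₂; [_,_]′)
open import Function using (_∘_; id)
open import Relation.Binary using (DecidableEquality; tri<; tri≈; tri>)
open import Relation.Binary.PropositionalEquality using (_≡_; _≢_; refl; sym; trans; cong; subst)
open import Relation.Nullary using (¬_; Dec; yes; no; contradiction; ¬?)

-- Simple paths, and the absence of thetas in chordless graphs

lookup-injective : ∀ {A : Set} {xs : List A} → Unique xs →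
                   ∀ i j → lookup xs i ≡ lookup xs j → i ≡ j
lookup-injective (_ ∷ _)  zero    zero    _  = refl
lookup-injective (px ∷ _) zero    (suc j) eq = contradiction eq (All.lookup px (∈-lookup j))
lookup-injective (px ∷ _) (suc i) zero    eq = contradiction (sym eq) (All.lookup px (∈-lookup i))
lookup-injective (_ ∷ u)  (suc i) (suc j) eq = cong suc (lookup-injective u i j eq)

module Walks {A : Set} (_≟_ : DecidableEquality A)
             (E : A → A → Set) (E-sym : ∀ {x y} → E x y → E y x) where

  open import Data.List.Membership.DecPropositional _≟_ using (_∈?_)

  data Reach (S : A → Set) : A → A → Set where
    stop : ∀ {x} → S x → Reach S x x
    step : ∀ {x y z} → S x → E x y → Reach S y z → Reach S x z

  module _ {S : A → Set} where

    start : ∀ {x y} → Reach S x y → S x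
    start (stop s)     = s
    start (step s _ _) = s

    infixr 5 _◅◅_
    _◅◅_ : ∀ {x y z} → Reach S x y → Reach S y z → Reach S x z
    stop _     ◅◅ q = q
    step s e p ◅◅ q = step s e (p ◅◅ q)

    reverse : ∀ {x y} → Reach S x y → Reach S y x
    reverse (stop s)     = stop s
    reverse (step s e p) = reverse p ◅◅ step (start p) (E-sym e) (stop s)

  weaken : ∀ {S T : A → Set} → (∀ {z} → S z → T z) → ∀ {x y} → Reach S x y → Reach T x y
  weaken f (stop s)     = stop (f s)
  weaken f (step s e p) = step (f s) e (weaken f p)

  data Trail : A → List A → A → Set where
    [_] : ∀ x → Trail x (x ∷ []) x
    _◅_ : ∀ {x y z ps} → E x y → Trail y ps z → Trail x (x ∷ ps) z

  trail-append : ∀ {x y z ps qs} → Trail x ps y → Trail y (y ∷ qs) z → Trail x (ps ++ qs) z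
  trail-append [ _ ]   q = q
  trail-append (e ◅ p) q = e ◅ trail-append p q

  trail-last : ∀ {x y ps} → Trail x ps y → y ∈ ps
  trail-last [ _ ]   = here refl
  trail-last (_ ◅ p) = there (trail-last p)

  trail-drop : ∀ {S : A → Set} {w x y ps} → Trail x ps y → Unique ps → All S ps → w ∈ ps →
               ∃[ qs ] Trail w qs y × Unique qs × All S qs
  trail-drop [ x ]   u        s        (here refl) = _ , [ x ] , u , s
  trail-drop (e ◅ p) u        s        (here refl) = _ , e ◅ p , u , s
  trail-drop (e ◅ p) (_ ∷ us) (_ ∷ ss) (there w∈)  = trail-drop p us ss w∈

  -- Loop erasure: if `x` recurs in the simple path already built from `y`, everything before that
  -- occurrence is cut off.
  simplify : ∀ {S : A → Set} {x y} → Reach S x y → ∃[ ps ] Trail x ps y × Unique ps × All S ps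
  simplify (stop s) = _ , [ _ ] , [] ∷ [] , s ∷ []
  simplify {x = x} (step s e p) with simplify p
  ... | ps , t , u , ss with x ∈? ps
  ...   | yes x∈ = trail-drop t u ss x∈
  ...   | no  x∉ = x ∷ ps , e ◅ t , All.¬Any⇒All¬ ps x∉ ∷ u , s ∷ ss

  trail-link : ∀ {x y ps} → Trail x ps y → ∀ i (p : suc (toℕ i) < length ps) →
               E (lookup ps i) (lookup ps (fromℕ< p))
  trail-link [ _ ]         zero    (s≤s ())
  trail-link (e ◅ [ _ ])   zero    p         = e
  trail-link (e ◅ (_ ◅ _)) zero    p         = e
  trail-link (_ ◅ t)       (suc i) (s≤s p)   = trail-link t i p

  trail-end : ∀ {x y ps} → Trail x ps y → ∀ i → ¬ (suc (toℕ i) < length ps) → lookup ps i ≡ y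
  trail-end [ _ ]         zero    _  = refl
  trail-end (_ ◅ [ _ ])   zero    ¬p = contradiction (s≤s (s≤s z≤n)) ¬p
  trail-end (_ ◅ (_ ◅ _)) zero    ¬p = contradiction (s≤s (s≤s z≤n)) ¬p
  trail-end (_ ◅ t)       (suc i) ¬p = trail-end t i (¬p ∘ s≤s)

  -- An edge u v together with two internally disjoint u–v paths of length at
  -- least two is a cycle with a chord.
  ThetaFree : Set₁
  ThetaFree = ∀ {S T : A → Set} {u v x y} → E u v → E u x → E u y → x ≢ v → y ≢ v →
              Reach S x v → Reach T y v → ¬ S u → ¬ T u →
              (∀ {z} → S z → T z → z ≡ v) → ⊥

  module _ {n} (G : Graph n) (chordless : Chordless G) (φ : A → Fin n)
           (φ-inj : ∀ {x y} → φ x ≡ φ y → x ≡ y)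
           (φ-adj : ∀ {x y} → E x y → adj G (φ x) (φ y) ≡ true) where

    -- Three vertices are exposed to match the minimal length in `Cycle`. The chord is based at
    -- index zero, whose cyclic neighbours are `c₁` and the last vertex `y`.
    no-chord : ∀ {c₀ c₁ c₂ cs y v} → Trail c₀ (c₀ ∷ c₁ ∷ c₂ ∷ cs) y →
               Unique (c₀ ∷ c₁ ∷ c₂ ∷ cs) → E y c₀ →
               v ∈ c₀ ∷ c₁ ∷ c₂ ∷ cs → v ≢ c₁ → v ≢ y → E c₀ v → ⊥
    no-chord {c₀} {c₁} {c₂} {cs} {y} {v} t u close v∈ v≢c₁ v≢y chord =
      chordless cycle (zero , j , adjacent , not-next , not-prev)
      where
      c : List A
      c = c₀ ∷ c₁ ∷ c₂ ∷ cs
      j : Fin (length c)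
      j = Any.index v∈
      at-j : v ≡ lookup c j
      at-j = lookup-index v∈
      link : ∀ i → E (lookup c i) (lookup c (next i))
      link i with suc (toℕ i) <? suc (suc (suc (length cs)))
      ... | yes p = trail-link t i p
      -- At the last index `next` wraps round to zero, so the edge needed is `close`.
      ... | no ¬p = subst (λ x → E x c₀) (sym (trail-end t i ¬p)) close
      cycle : Cycle G
      cycle = record
        { len    = length cs
        ; vtx    = φ ∘ lookup c
        ; inj    = λ i k eq → lookup-injective u i k (φ-inj eq)
        ; consec = λ i → φ-adj (link i)
        }
      adjacent : adj G (φ c₀) (φ (lookup c j)) ≡ true
      adjacent = φ-adj (subst (E c₀) at-j chord)
      not-next : j ≢ suc zero
      not-next eq = v≢c₁ (trans at-j (cong (lookup c) eq))
      not-prev : zero ≢ next j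
      not-prev eq with suc (toℕ j) <? suc (suc (suc (length cs)))
      not-prev () | yes _
      ... | no ¬p = v≢y (trans at-j (trail-end t j ¬p))

    -- The cycle runs from `u` along the first path to `v` and back along the reversed second path;
    -- `u v` is its chord. Each simplified path has a further vertex besides `v`, because `x` and
    -- `y` differ from `v`.
    thetaFree : ThetaFree
    thetaFree {S} {T} {u} {v} {x} {y} uv ux uy x≢v y≢v p q ¬Su ¬Tu meet
      with simplify p | simplify (reverse q)
    ... | _ , [ _ ] , _ | _ = contradiction refl x≢v
    ... | _ , _ ◅ _ , _ | _ , [ _ ] , _ = contradiction refl y≢v
    ... | _ , e ◅ p′ , ps! , Ss | _ , f ◅ q′ , qs! , Ts = close e p′ ps! Ss f q′ qs! Ts
      where
      unique : ∀ {ps qs} → Unique ps → All S ps → Unique (v ∷ qs) → All T (v ∷ qs) →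
               Unique (u ∷ ps ++ qs)
      unique ps! Ss (v∉ ∷ qs!) (_ ∷ Ts) =
        All.++⁺ (All.map (λ Sz u≡z → ¬Su (subst S (sym u≡z) Sz)) Ss)
                (All.map (λ Tz u≡z → ¬Tu (subst T (sym u≡z) Tz)) Ts)
        ∷ Unique.++⁺ ps! qs! (λ (z∈ps , z∈qs) →
            All.lookup v∉ z∈qs (sym (meet (All.lookup Ss z∈ps) (All.lookup Ts z∈qs))))

      close : ∀ {x′ y′ ps qs} → E x x′ → Trail x′ ps v → Unique (x ∷ ps) → All S (x ∷ ps) →
              E v y′ → Trail y′ qs y → Unique (v ∷ qs) → All T (v ∷ qs) → ⊥
      -- The two cases differ only in which vertex comes third; `no-chord` has to see it.
      close e [ _ ] ps! Ss f q′ qs! Ts =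
        no-chord (ux ◅ (e ◅ (f ◅ q′))) (unique ps! Ss qs! Ts) (E-sym uy)
                 (there (there (here refl))) (x≢v ∘ sym) (y≢v ∘ sym) uv
      close e p′@(_ ◅ _) ps! Ss f q′ qs! Ts =
        no-chord (ux ◅ trail-append (e ◅ p′) (f ◅ q′)) (unique ps! Ss qs! Ts) (E-sym uy)
                 (there (there (∈-++⁺ˡ (trail-last p′)))) (x≢v ∘ sym) (y≢v ∘ sym) uv

-- Positions on the depth-first stack

-- Heights are counted from the bottom of the stack, so that pushing preserves them.
data At {A : Set} : List A → ℕ → A → Set where
  here  : ∀ {x R} → At (x ∷ R) (length R) x
  there : ∀ {x R d z} → At R d z → At (x ∷ R) d z

module _ {A : Set} where

  At-< : ∀ {R : List A} {d z} → At R d z → d < length R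
  At-< here      = ≤-refl
  At-< (there p) = m≤n⇒m≤1+n (At-< p)

  At⇒∈ : ∀ {R : List A} {d z} → At R d z → z ∈ R
  At⇒∈ here      = here refl
  At⇒∈ (there p) = there (At⇒∈ p)

  ∈⇒At : ∀ {R : List A} {z} → z ∈ R → ∃[ d ] At R d z
  ∈⇒At (here refl) = _ , here
  ∈⇒At (there z∈)  = let d , p = ∈⇒At z∈ in d , there p

  At-pop : ∀ {R : List A} {x d z} → At (x ∷ R) d z → d < length R → At R d z
  At-pop here      d< = contradiction d< (<-irrefl refl)
  At-pop (there p) _  = p

  At-functional : ∀ {R : List A} {d y z} → At R d y → At R d z → y ≡ z
  At-functional here      here      = refl
  At-functional here      (there q) = contradiction (At-< q) (<-irrefl refl)
  At-functional (there p) here      = contradiction (At-< p) (<-irrefl refl)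
  At-functional (there p) (there q) = At-functional p q

  At-injective : ∀ {R : List A} {c d z} → Unique R → At R c z → At R d z → c ≡ d
  At-injective _        here      here      = refl
  At-injective u        here      (there q) = contradiction (At⇒∈ q) (Unique.Unique[x∷xs]⇒x∉xs u)
  At-injective u        (there p) here      = contradiction (At⇒∈ p) (Unique.Unique[x∷xs]⇒x∉xs u)
  At-injective (_ ∷ u)  (there p) (there q) = At-injective u p q

  Segment : List A → ℕ → ℕ → A → Set
  Segment R i j z = ∃[ d ] At R d z × i ≤ d × d ≤ j

-- Branches leaving a stack vertex, and why two of them clash

module Branches {A : Set} (_≟_ : DecidableEquality A)
                (E : A → A → Set) (E-sym : ∀ {x y} → E x y → E y x) where

  open Walks _≟_ E E-sym public

  record Stack (R : List A) : Set where
    constructor stack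
    field
      linked : Linked E R
      unique : Unique R
  open Stack public

  pop : ∀ {x R} → Stack (x ∷ R) → Stack R
  pop (stack [-]     (_ ∷ u)) = stack [] u
  pop (stack (_ ∷ l) (_ ∷ u)) = stack l u

  top-link : ∀ {x y R} → Stack (x ∷ y ∷ R) → E x y
  top-link (stack (e ∷ _) _) = e

  top-∉ : ∀ {x R} → Stack (x ∷ R) → x ∉ R
  top-∉ (stack _ u) = Unique.Unique[x∷xs]⇒x∉xs u

  descend : ∀ {R i j x y} → Linked E R → At R i x → At R j y → i ≤ j → Reach (Segment R i j) y x
  descend l here here _ = stop (_ , here , ≤-refl , ≤-refl)
  descend l here (there q) i≤j = contradiction (At-< q) (≤⇒≯ i≤j)
  descend [-] (there ()) here _
  descend (e ∷ l) (there p) here i≤j =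
    step (_ , here , i≤j , ≤-refl) e
         (weaken (λ (d , at , i≤d , d≤j) → d , there at , i≤d , m≤n⇒m≤1+n d≤j)
                 (descend l p here (m<1+n⇒m≤n (At-< p))))
  descend [-] (there ()) (there _) _
  descend (_ ∷ l) (there p) (there q) i≤j =
    weaken (λ (d , at , bounds) → d , there at , bounds) (descend l p q i≤j)

  between : ∀ {R i j k x y} → Linked E R → At R i x → At R j y → i < k → j < k →
            Reach (λ z → ∃[ d ] At R d z × d < k) x y
  between {i = i} {j = j} l p q i<k j<k with ≤-total i j
  ... | inj₁ i≤j = reverse (weaken (λ (d , at , _ , d≤j) → d , at , ≤-<-trans d≤j j<k)
                                   (descend l p q i≤j))
  ... | inj₂ j≤i = weaken (λ (d , at , _ , d≤i) → d , at , ≤-<-trans d≤i i<k)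
                          (descend l q p j≤i)

  -- A way out of x through the set Vis that ends at the vertex `exit` of R, where
  -- x ∷ R is the current stack.
  record Branch (x : A) (R : List A) (Vis : A → Set) : Set₁ where
    field
      first exit : A
      -- The names picture the tree with its root on top: higher means a smaller number. `low`
      -- bounds the part of the stack that a second connection must avoid.
      high low   : ℕ
      link       : E x first
      exit-at    : At R high exit
      fresh      : ∀ {z} → Vis z → z ∉ x ∷ R
      reach      : Reach (λ z → Vis z ⊎ z ≡ exit) first exit
      -- The last edge into `exit` is a chord as soon as x has a second
      -- connection to `exit`.
      dominant   : ∀ {S y} → E x y → y ≢ exit → Reach S y exit → ¬ S x →
                   (∀ {z} → S z → ¬ Vis z) →
                   (∀ {z d} → S z → At R d z → high < d → d ≤ low → ⊥) → ⊥
  open Branch public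

  -- Growing `Vis` and `low` only demands more of `S` in `dominant`.
  enlarge : ∀ {x R Vis Vis′ l} (β : Branch x R Vis) → (∀ {z} → Vis z → Vis′ z) →
            (∀ {z} → Vis′ z → z ∉ x ∷ R) → low β ≤ l → Branch x R Vis′
  enlarge {l = l} β sub fresh′ low≤l = record
    { first = first β ; exit = exit β ; high = high β ; low = l
    ; link = link β ; exit-at = exit-at β ; fresh = fresh′
    ; reach = weaken [ inj₁ ∘ sub , inj₂ ]′ (reach β)
    ; dominant = λ xy y≢ p ¬Sx ¬Vis ¬seg →
        dominant β xy y≢ p ¬Sx (λ Sz → ¬Vis Sz ∘ sub)
          (λ Sz at h<d d≤ → ¬seg Sz at h<d (≤-trans d≤ low≤l))
    }

  -- Prefixing the edge `x y` turns a second connection of `y` to the exit into one of `x`. The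
  -- bounds on `high` and `low` keep `y`, at height `length R`, from being the exit or lying in the
  -- forbidden stretch.
  lift : ∀ {x y R Vis} → Stack (x ∷ y ∷ R) → (β : Branch x (y ∷ R) Vis) →
         high β < length R → low β < length R → Branch y R (λ z → Vis z ⊎ z ≡ x)
  lift {x} {y} {R} {Vis} st β high< low< = record
    { first = x ; exit = exit β ; high = high β ; low = low β
    ; link = E-sym (top-link st)
    ; exit-at = At-pop (exit-at β) high<
    ; fresh = λ { (inj₁ v) z∈ → fresh β v (there z∈) ; (inj₂ refl) z∈ → top-∉ st z∈ }
    ; reach = step (inj₁ (inj₂ refl)) (link β) (weaken [ inj₁ ∘ inj₁ , inj₂ ]′ (reach β))
    ; dominant = λ {S} yw w≢ p ¬Sy ¬Vis ¬seg →
        dominant β {S = λ z → S z ⊎ z ≡ y} (top-link st) y≢exit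
          (step (inj₂ refl) yw (weaken inj₁ p))
          (λ { (inj₁ Sx) → ¬Vis Sx (inj₂ refl) ; (inj₂ x≡y) → top-∉ st (here x≡y) })
          (λ { (inj₁ Sz) v → ¬Vis Sz (inj₁ v) ; (inj₂ refl) v → fresh β v (there (here refl)) })
          (λ { (inj₁ Sz) at h<d d≤ → ¬seg Sz (At-pop at (≤-<-trans d≤ low<)) h<d d≤
             ; (inj₂ refl) at h<d d≤ →
                 top-∉ (pop st) (At⇒∈ (At-pop at (≤-<-trans d≤ low<))) })
    }
    where
    y≢exit : y ≢ exit β
    y≢exit refl = top-∉ (pop st) (At⇒∈ (At-pop (exit-at β) high<))

  module _ (theta : ThetaFree) where

    -- The chord is `x s` itself: the route through `c` and any further connection form a theta with
    -- it. Only the vertices of that route have to be avoided, which fixes `Vis` and `low`.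
    edge-branch : ∀ {x R Vis h l s c} → Stack (x ∷ R) → (∀ {z} → Vis z → z ∉ x ∷ R) →
                  E x s → At R h s → E x c → c ≢ s →
                  Reach (λ z → Vis z ⊎ Segment R h l z) c s → Branch x R Vis
    edge-branch {x} {R} {Vis} {h} {l} {s} st fr xs at xc c≢s p = record
      { first = s ; exit = s ; high = h ; low = l
      ; link = xs ; exit-at = at ; fresh = fr ; reach = stop (inj₂ refl)
      ; dominant = λ xy y≢s q ¬Sx ¬Vis ¬seg →
          theta xs xc xy c≢s y≢s p q
            (λ { (inj₁ v) → fr v (here refl) ; (inj₂ (_ , at′ , _)) → top-∉ st (At⇒∈ at′) })
            ¬Sx
            (λ { (inj₁ v) Sz → ⊥-elim (¬Vis Sz v)
               ; (inj₂ (d , at′ , h≤d , d≤l)) Sz → meet ¬seg at′ h≤d d≤l Sz })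
      }
      where
      meet : ∀ {S : A → Set} {z d} → (∀ {z d} → S z → At R d z → h < d → d ≤ l → ⊥) →
             At R d z → h ≤ d → d ≤ l → S z → z ≡ s
      meet ¬seg at′ h≤d d≤l Sz with m≤n⇒m<n∨m≡n h≤d
      ... | inj₁ h<d  = ⊥-elim (¬seg Sz at′ h<d d≤l)
      ... | inj₂ refl = At-functional at′ at

    -- The route through the parent `r` along the stack serves as first path, so nothing is visited
    -- and `low` is the height of `r`.
    back-edge : ∀ {x r R h s} → Stack (x ∷ r ∷ R) → E x s → At R h s →
                Branch x (r ∷ R) (λ _ → ⊥)
    back-edge {r = r} {R} {h} {s} st xs at =
      edge-branch {l = length R} st (λ ()) xs (there at) (top-link st)
        (λ { refl → top-∉ (pop st) (At⇒∈ at) })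
        (weaken inj₂ (descend (linked (pop st)) (there at) here (<⇒≤ (At-< at))))

    module _ {x R} (st : Stack (x ∷ R)) where

      -- After leaving through `γ`, one can follow the stack away from the root up to `exit β`. This
      -- uses heights at most `high β`, hence is a second connection forbidden by `dominant β`.
      higher-exit : ∀ {Vis Vis′} (β : Branch x R Vis) (γ : Branch x R Vis′) →
                    (∀ {z} → Vis z → ¬ Vis′ z) → high γ ≤ high β → first γ ≢ exit β → ⊥
      higher-exit {Vis} {Vis′} β γ disj h≤ f≢ =
        dominant β {S = λ z → Vis′ z ⊎ Segment R 0 (high β) z} (link γ) f≢
          (weaken [ inj₁ , (λ { refl → inj₂ (_ , exit-at γ , z≤n , h≤) }) ]′ (reach γ)
            ◅◅ weaken (λ (d , at , _ , d≤) → inj₂ (d , at , z≤n , d≤))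
                 (reverse (descend (linked (pop st)) (exit-at γ) (exit-at β) h≤)))
          (λ { (inj₁ v) → fresh γ v (here refl) ; (inj₂ (_ , at , _)) → top-∉ st (At⇒∈ at) })
          (λ { (inj₁ v′) v → disj v v′ ; (inj₂ (_ , at , _)) v → fresh β v (there (At⇒∈ at)) })
          (λ { (inj₁ v) at _ _ → fresh γ v (there (At⇒∈ at))
             ; (inj₂ (c , at′ , _ , c≤)) at h<d _ →
                 <⇒≱ h<d (subst (_≤ high β) (At-injective (unique (pop st)) at′ at) c≤) })

      first≢exit : ∀ {Vis Vis′} (γ : Branch x R Vis) (β : Branch x R Vis′) →
                   high γ ≢ high β → first γ ≢ exit β
      first≢exit γ β h≢ refl with start (reach γ)
      ... | inj₁ v  = fresh γ v (there (At⇒∈ (exit-at β)))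
      ... | inj₂ eq = h≢ (At-injective (unique (pop st)) (exit-at γ)
                            (subst (At R (high β)) eq (exit-at β)))

      -- The branch whose exit is farther from the root supplies the chord. At equal heights the
      -- exits coincide, and as the first vertices differ, at most one of them is the exit itself;
      -- this decides the roles.
      two-branches : ∀ {Vis Vis′} (β : Branch x R Vis) (γ : Branch x R Vis′) →
                     (∀ {z} → Vis z → ¬ Vis′ z) → first β ≢ first γ → ⊥
      two-branches β γ disj f≢ with <-cmp (high γ) (high β)
      ... | tri< γ<β γ≢β _ = higher-exit β γ disj (<⇒≤ γ<β) (first≢exit γ β γ≢β)
      ... | tri> _ γ≢β β<γ = higher-exit γ β (λ v′ v → disj v v′) (<⇒≤ β<γ) (first≢exit β γ (γ≢β ∘ sym))
      ... | tri≈ _ γ≡β _ with first γ ≟ exit β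
      ...   | no f≢e  = higher-exit β γ disj (≤-reflexive γ≡β) f≢e
      ...   | yes f≡e = higher-exit γ β (λ v′ v → disj v v′) (≤-reflexive (sym γ≡β))
                          (λ f≡e′ → f≢ (trans f≡e′ (trans same (sym f≡e))))
        where
        same : exit γ ≡ exit β
        same = At-functional (exit-at γ) (subst (λ d → At R d (exit β)) (sym γ≡β) (exit-at β))

-- The spanning structure on matching endpoints and the search invariants

module Ports {m : ℕ} (hadj : Fin m → Fin m → Bool) (hsym : ∀ e f → hadj e f ≡ hadj f e)
             (hirr : ∀ {e} → hadj e e ≢ true) (port : Fin m → Fin m → Bool) where

  V : Set
  V = Fin m × Bool

  _≟_ : DecidableEquality V
  _≟_ = ≡-dec Fin._≟_ Bool._≟_

  open import Data.List.Membership.DecPropositional (Fin._≟_ {m}) using (_∈?_)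

  -- `(e , σ)` stands for an endpoint of a matching edge. Besides the matching edges there is one
  -- edge per edge of H, attached to `e` at the side `port e f`.
  data E : V → V → Set where
    mate : ∀ {e σ τ} → τ ≡ not σ → E (e , σ) (e , τ)
    join : ∀ {e f σ τ} → hadj e f ≡ true → port e f ≡ σ → port f e ≡ τ → E (e , σ) (f , τ)

  E-sym : ∀ {x y} → E x y → E y x
  E-sym (mate {σ = σ} refl) = mate (sym (Bool.not-involutive σ))
  E-sym (join {e} {f} h p q) = join (trans (hsym f e) h) q p

  E-irrefl : ∀ {x} → ¬ E x x
  E-irrefl (mate {σ = true} ())
  E-irrefl (mate {σ = false} ())
  E-irrefl (join h _ _) = hirr h

  E? : ∀ x y → Dec (E x y)
  E? (e , σ) (f , τ) with hadj e f Bool.≟ true | port e f Bool.≟ σ | port f e Bool.≟ τ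
  ... | yes h | yes p | yes q = yes (join h p q)
  ... | no ¬h | _     | _     = mate? ¬h
    where
    mate? : hadj e f ≢ true → Dec (E (e , σ) (f , τ))
    mate? ¬h with e Fin.≟ f | τ Bool.≟ not σ
    ... | yes refl | yes eq = yes (mate eq)
    ... | yes refl | no ne  = no λ { (mate eq) → ne eq ; (join h _ _) → hirr h }
    ... | no e≢f   | _      = no λ { (mate _) → e≢f refl ; (join h _ _) → ¬h h }
  ... | yes h | no ¬p | _     = no λ { (mate _) → hirr h ; (join _ p _) → ¬p p }
  ... | yes h | yes _ | no ¬q = no λ { (mate _) → hirr h ; (join _ _ q) → ¬q q }

  open Branches _≟_ E E-sym public

  _∖_ : List (Fin m) → Fin m → List (Fin m)
  W ∖ e = filter (λ g → ¬? (g Fin.≟ e)) W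

  ∖-⊆ : ∀ {W e} → W ∖ e ⊆ W
  ∖-⊆ g∈ = proj₁ (∈-filter⁻ (λ g → ¬? (g Fin.≟ _)) g∈)

  ∉-∖ : ∀ W {e} → e ∉ W ∖ e
  ∉-∖ W e∈ = proj₂ (∈-filter⁻ (λ g → ¬? (g Fin.≟ _)) {xs = W} e∈) refl

  ∈-∖ : ∀ {W e g} → g ∈ W → g ≢ e → g ∈ W ∖ e
  ∈-∖ = ∈-filter⁺ (λ g → ¬? (g Fin.≟ _))

  ∖-shorter : ∀ {W e} → e ∈ W → length (W ∖ e) < length W
  ∖-shorter e∈ = filter-notAll (λ g → ¬? (g Fin.≟ _)) _ (Any.map (λ { refl ¬p → ¬p refl }) e∈)

  Separate : List V → List (Fin m) → Set
  Separate R W = ∀ {z} → z ∈ R → proj₁ z ∉ W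

  -- The depth-first invariant: no finished subtree is adjacent to an unexplored vertex.
  Closed : List (Fin m) → List V → Set
  Closed W R = ∀ {x z} → proj₁ x ∈ W → E x z → z ∈ R ⊎ proj₁ z ∈ W

  Visited : List (Fin m) → List (Fin m) → V → Set
  Visited W W′ z = proj₁ z ∈ W × proj₁ z ∉ W′

  -- The neighbour in the first component shows that `g` lies in H and lets a new search start at
  -- `g`.
  Small : Fin m → Set
  Small g = (∃[ f ] hadj g f ≡ true) × ∃[ p ] ∃[ q ] (∀ f → hadj g f ≡ true → f ≡ p ⊎ f ≡ q)

  Found : List (Fin m) → Set
  Found W = ∃[ g ] g ∈ W × Small g

  found-⊆ : ∀ {W W′} → W′ ⊆ W → Found W′ → Found W
  found-⊆ sub (g , g∈ , s) = g , sub g∈ , s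

  -- W′ is what remains of the unexplored set W.
  Outcome : List (Fin m) → List V → (List (Fin m) → Set₁) → Set₁
  Outcome W R P = Found W ⊎ (∃[ W′ ] W′ ⊆ W × length W′ ≤ length W × Closed W′ R × P W′)

  -- The shape of an explored subtree, hanging from x, without small vertices.  Its root
  -- pair is (first branch , leaf); among its exits into R, the one farthest from the root
  -- is leaf′, at height `low branch`.
  record Kid (x : V) (R : List V) (Vis : V → Set) : Set₁ where
    field
      branch       : Branch x R Vis
      leaf leaf′   : V
      first∈       : Vis (first branch)
      leaf∈        : Vis leaf
      first-leaf   : E (first branch) leaf
      leaf-link    : E leaf leaf′
      leaf′-at     : At R (low branch) leaf′
      leaf′≢       : proj₁ leaf′ ≢ proj₁ x
      high<low     : high branch < low branch
      -- A route to the exit that spares `leaf`, so that `leaf` and its back edge can carry the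
      -- other path of a theta.
      around       : Reach (λ z → (Vis z × z ≢ leaf) ⊎ z ≡ exit branch) (first branch) (exit branch)
      exits        : ∀ {z z′ d} → Vis z → E z z′ → At R d z′ → d ≤ low branch
      entry        : ∀ {z} → Vis z → E z x → z ≡ first branch
  open Kid public

  -- When `x` sits on its own mate `y`, `leaf′≢` rules out `y` as the end of the leaf's back edge.
  low-pop : ∀ {x y R Vis} → proj₁ x ≡ proj₁ y → (κ : Kid x (y ∷ R) Vis) → low (branch κ) < length R
  low-pop {R = R} x≡y κ = go (leaf′-at κ) (leaf′≢ κ)
    where
    go : ∀ {d z} → At (_ ∷ R) d z → proj₁ z ≢ _ → d < length R
    go here       z≢ = contradiction (sym x≡y) z≢
    go (there at) _  = At-< at

  -- The ways `x` can continue besides its parent `r`; `two-branches` leaves room for at most one.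
  data Arms (x r : V) (R : List V) (W : List (Fin m)) : List (Fin m) → Set₁ where
    none : (∀ {z} → E x z → z ∈ R ⊎ proj₁ z ∈ W → ⊥) → Arms x r R W W
    back : ∀ {h s} → At R h s → E x s →
           (∀ {z} → E x z → z ∈ R ⊎ proj₁ z ∈ W → z ≡ s) → Arms x r R W W
    kid  : ∀ {W′} (κ : Kid x (r ∷ R) (Visited W W′)) →
           (∀ {z} → E x z → z ∈ R ⊎ proj₁ z ∈ W → z ≡ first (branch κ)) → Arms x r R W W′

  white? : ∀ x W → Dec (∃[ z ] proj₁ z ∈ W × E x z)
  white? x [] = no λ ()
  white? x (g ∷ W) with E? x (g , false) | E? x (g , true) | white? x W
  ... | yes e | _ | _ = yes (_ , here refl , e)
  ... | _ | yes e | _ = yes (_ , here refl , e)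
  ... | _ | _ | yes (z , z∈ , e) = yes (z , there z∈ , e)
  ... | no ¬f | no ¬t | no ¬W = no λ
    { ((_ , false) , here refl , e) → ¬f e
    ; ((_ , true) , here refl , e) → ¬t e
    ; (z , there z∈ , e) → ¬W (z , z∈ , e) }

  back? : ∀ x R → Dec (∃[ z ] z ∈ R × E x z)
  back? x R with any? (E? x) R
  ... | yes p = yes (find p)
  ... | no ¬p = no λ (z , z∈ , e) → ¬p (lose z∈ e)

  -- The depth-first search

  module Search (theta : ThetaFree) where

    -- Otherwise the edge from a to first (branch κ) is a chord.
    low-exit : ∀ {a v R Vis b t d} → Stack (a ∷ v ∷ R) → (κ : Kid a (v ∷ R) Vis) →
               E a b → E b t → At (v ∷ R) d t → b ∉ a ∷ v ∷ R → ¬ Vis b → low (branch κ) ≤ d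
    low-exit {a} {v} {R} {Vis} {b} {t} {d} st κ ab bt at b∉ ¬b = ≮⇒≥ λ d<low →
      theta {S = λ z → Segment (v ∷ R) (low β) (length R) z ⊎ z ≡ leaf κ ⊎ z ≡ first β}
            {T = λ z → z ≡ b ⊎ (∃[ c ] At (v ∷ R) c z × c < low β) ⊎ (Vis z × z ≢ leaf κ)}
        (link β) (top-link st) ab
        (λ { refl → fresh β (first∈ κ) (there (here refl)) })
        (λ { refl → ¬b (first∈ κ) })
        -- The first path follows the stack from `v` to `leaf′ κ` and enters `first β` through
        -- `leaf κ`. The second goes from `b` to `t`, along the stack strictly closer to the root
        -- than `low β`, and back through `around κ`.
        (weaken inj₁ (descend l (leaf′-at κ) here (m<1+n⇒m≤n (At-< (leaf′-at κ))))
          ◅◅ step (inj₁ (_ , leaf′-at κ , ≤-refl , m<1+n⇒m≤n (At-< (leaf′-at κ)))) (E-sym (leaf-link κ))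
             (step (inj₂ (inj₁ refl)) (E-sym (first-leaf κ)) (stop (inj₂ (inj₂ refl)))))
        (step (inj₁ refl) bt
          (weaken (inj₂ ∘ inj₁) (between l at (exit-at β) d<low (high<low κ))
            ◅◅ weaken [ inj₂ ∘ inj₂ , (λ { refl → inj₂ (inj₁ (_ , exit-at β , high<low κ)) }) ]′
                      (reverse (around κ))))
        (λ { (inj₁ (_ , at′ , _)) → top-∉ st (At⇒∈ at′)
           ; (inj₂ (inj₁ refl)) → fresh β (leaf∈ κ) (here refl)
           ; (inj₂ (inj₂ refl)) → fresh β (first∈ κ) (here refl) })
        (λ { (inj₁ refl) → b∉ (here refl)
           ; (inj₂ (inj₁ (_ , at′ , _))) → top-∉ st (At⇒∈ at′)
           ; (inj₂ (inj₂ (v , _))) → fresh β v (here refl) })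
        (λ { (inj₂ (inj₂ eq)) _ → eq
           ; (inj₁ (_ , at′ , _)) (inj₁ refl) → contradiction (there (At⇒∈ at′)) b∉
           ; (inj₁ (_ , at′ , low≤ , _)) (inj₂ (inj₁ (_ , at″ , <low))) →
               contradiction (subst (low β ≤_) (At-injective (unique (pop st)) at′ at″) low≤) (<⇒≱ <low)
           ; (inj₁ (_ , at′ , _)) (inj₂ (inj₂ (v , _))) → contradiction (there (At⇒∈ at′)) (fresh β v)
           ; (inj₂ (inj₁ refl)) (inj₁ refl) → contradiction (leaf∈ κ) ¬b
           ; (inj₂ (inj₁ refl)) (inj₂ (inj₁ (_ , at″ , _))) →
               contradiction (there (At⇒∈ at″)) (fresh β (leaf∈ κ))
           ; (inj₂ (inj₁ eq)) (inj₂ (inj₂ (_ , ≢leaf))) → contradiction eq ≢leaf })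
      where
      β = branch κ
      l = linked (pop st)

    Explorer : ℕ → Set₁
    Explorer k = ∀ {x R e σ W} → length W ≤ k → Stack (x ∷ R) → Separate (x ∷ R) W → e ∈ W →
                 Closed W (x ∷ R) → E x (e , σ) →
                 Outcome W (x ∷ R) (λ W′ → Kid x R (Visited W W′))

    drop-top : ∀ {x R W} → Closed W (x ∷ R) → ¬ (∃[ z ] proj₁ z ∈ W × E x z) → Closed W R
    drop-top clo none∈ y∈ e with clo y∈ e
    ... | inj₁ (here refl) = contradiction (_ , y∈ , E-sym e) none∈
    ... | inj₁ (there z∈)  = inj₁ z∈
    ... | inj₂ z∈          = inj₂ z∈

    -- After one back edge or one explored kid, any further unexplored neighbour or back edge would
    -- be a second branch at `x`.
    arms : ∀ {k} → Explorer k → ∀ {x r R W} → length W ≤ k → Stack (x ∷ r ∷ R) →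
           Separate (x ∷ r ∷ R) W → Closed W (x ∷ r ∷ R) →
           Outcome W (r ∷ R) (Arms x r R W)
    arms explore {x} {r} {R} {W} len st sep clo with white? x W
    ... | no ¬white = inj₂ (W , id , ≤-refl , drop-top clo ¬white , only-back)
      where
      only-back : Arms x r R W W
      only-back with back? x R
      ... | no ¬back = none λ { e (inj₁ z∈) → ¬back (_ , z∈ , e)
                              ; e (inj₂ z∈) → ¬white (_ , z∈ , e) }
      ... | yes (s , s∈ , xs) = back (proj₂ (∈⇒At s∈)) xs only
        where
        only : ∀ {z} → E x z → z ∈ R ⊎ proj₁ z ∈ W → z ≡ s
        only {z} e (inj₂ z∈) = contradiction (_ , z∈ , e) ¬white
        only {z} e (inj₁ z∈) with z ≟ s
        ... | yes eq = eq
        ... | no z≢s = ⊥-elim (two-branches theta st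
                         (back-edge theta st e (proj₂ (∈⇒At z∈)))
                         (back-edge theta st xs (proj₂ (∈⇒At s∈))) (λ ()) z≢s)
    ... | yes (_ , g∈ , xg) with explore len st sep g∈ clo xg
    ...   | inj₁ found = inj₁ found
    ...   | inj₂ (W₁ , W₁⊆ , len₁ , clo₁ , κ) with white? x W₁
    ...     | yes (_ , g′∈ , xg′) with explore (≤-trans len₁ len) st (λ z∈ → sep z∈ ∘ W₁⊆) g′∈ clo₁ xg′
    ...       | inj₁ found = inj₁ (found-⊆ W₁⊆ found)
    ...       | inj₂ (_ , _ , _ , _ , κ′) =
                  ⊥-elim (two-branches theta st (branch κ) (branch κ′)
                    (λ (_ , ∉W₁) (∈W₁ , _) → ∉W₁ ∈W₁)
                    (λ eq → proj₂ (first∈ κ) (subst (λ z → proj₁ z ∈ W₁) (sym eq) (proj₁ (first∈ κ′)))))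
    arms explore {x} {r} {R} {W} len st sep clo
      | yes (_ , g∈ , xg) | inj₂ (W₁ , W₁⊆ , len₁ , clo₁ , κ) | no ¬white =
      inj₂ (W₁ , W₁⊆ , len₁ , drop-top clo₁ ¬white , kid κ only)
      where
      only : ∀ {z} → E x z → z ∈ R ⊎ proj₁ z ∈ W → z ≡ first (branch κ)
      only {z} e (inj₁ z∈) = ⊥-elim (two-branches theta st
        (branch κ) (back-edge theta st e (proj₂ (∈⇒At z∈))) (λ _ ())
        (λ { refl → fresh (branch κ) (first∈ κ) (there (there z∈)) }))
      only {z} e (inj₂ z∈) with proj₁ z ∈? W₁
      ... | yes z∈₁ = contradiction (_ , z∈₁ , e) ¬white
      ... | no  z∉₁ = entry κ (z∈ , z∉₁) (E-sym e)

    module Pair {v R e σ W} (st : Stack (v ∷ R)) (sep : Separate (v ∷ R) W) (e∈ : e ∈ W)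
                (clo : Closed W (v ∷ R)) (va : E v (e , σ)) where

      a b : V
      a = e , σ
      b = e , not σ

      W₀ : List (Fin m)
      W₀ = W ∖ e

      W₀⊆ : W₀ ⊆ W
      W₀⊆ = ∖-⊆

      e∉W₀ : e ∉ W₀
      e∉W₀ = ∉-∖ W

      mate∉ : ∀ {τ} → (e , τ) ∉ v ∷ R
      mate∉ z∈ = sep z∈ e∈

      ab : E a b
      ab = mate refl

      b≢a : b ≢ a
      b≢a eq = E-irrefl (subst (E a) eq ab)

      b∉ : b ∉ a ∷ v ∷ R
      b∉ (here eq)  = b≢a eq
      b∉ (there z∈) = mate∉ z∈

      stᵃ : Stack (a ∷ v ∷ R)
      stᵃ = stack (E-sym va ∷ linked st) (All.¬Any⇒All¬ _ mate∉ ∷ unique st)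

      stᵇ : Stack (b ∷ a ∷ v ∷ R)
      stᵇ = stack (E-sym ab ∷ linked stᵃ) (All.¬Any⇒All¬ _ b∉ ∷ unique stᵃ)

      sepᵃ : Separate (a ∷ v ∷ R) W₀
      sepᵃ (here refl) = e∉W₀
      sepᵃ (there z∈)  = sep z∈ ∘ W₀⊆

      sepᵇ : Separate (b ∷ a ∷ v ∷ R) W₀
      sepᵇ (here refl) = e∉W₀
      sepᵇ (there z∈)  = sepᵃ z∈

      pair : ∀ {z} → proj₁ z ≡ e → z ≡ a ⊎ z ≡ b
      pair {_ , τ} refl with τ Bool.≟ σ
      ... | yes refl = inj₁ refl
      ... | no τ≢σ   = inj₂ (cong (e ,_) (Bool.¬-not τ≢σ))

      split : ∀ z → proj₁ z ∈ W → (z ≡ a ⊎ z ≡ b) ⊎ proj₁ z ∈ W₀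
      split z z∈ with proj₁ z Fin.≟ e
      ... | yes eq = inj₁ (pair eq)
      ... | no ne  = inj₂ (∈-∖ z∈ ne)

      cloᵇ : Closed W₀ (b ∷ a ∷ v ∷ R)
      cloᵇ {z = z} x∈ xz with clo (W₀⊆ x∈) xz
      ... | inj₁ z∈ = inj₁ (there (there z∈))
      ... | inj₂ z∈ with split z z∈
      ...   | inj₁ (inj₁ refl) = inj₁ (there (here refl))
      ...   | inj₁ (inj₂ refl) = inj₁ (here refl)
      ...   | inj₂ z∈₀         = inj₂ z∈₀

      -- There is only one edge between the pairs of a and v, and it is used at a.
      b-exit≢ : ∀ {z} → E b z → proj₁ z ≢ proj₁ v
      b-exit≢ bz refl with E-sym va | bz
      ... | mate _     | _          = sep (here refl) e∈
      ... | join _ _ _ | mate _     = sep (here refl) e∈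
      ... | join _ p _ | join _ q _ = Bool.not-¬ p q

      ev : hadj e (proj₁ v) ≡ true
      ev with E-sym va
      ... | mate _     = contradiction e∈ (sep (here refl))
      ... | join h _ _ = h

      other-b : ∀ {z} → E b z → z ≡ a ⊎ (z ∈ v ∷ R ⊎ proj₁ z ∈ W₀)
      other-b {z} bz with clo e∈ bz
      ... | inj₁ z∈ = inj₂ (inj₁ z∈)
      ... | inj₂ z∈ with split z z∈
      ...   | inj₁ (inj₁ eq)   = inj₁ eq
      ...   | inj₁ (inj₂ refl) = contradiction bz E-irrefl
      ...   | inj₂ z∈₀         = inj₂ (inj₂ z∈₀)

      -- A neighbour of `a` inside the kid of `b` would be an exit at the height of `a`, above the
      -- bound that `low-pop` puts on `low`.
      other-a : ∀ {W₁} → Arms b a (v ∷ R) W₀ W₁ →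
                ∀ {z} → E a z → z ≡ v ⊎ z ≡ b ⊎ (z ∈ R ⊎ proj₁ z ∈ W₁)
      other-a {W₁} βs {z} az with clo e∈ az
      ... | inj₁ (here eq)  = inj₁ eq
      ... | inj₁ (there z∈) = inj₂ (inj₂ (inj₁ z∈))
      ... | inj₂ z∈ with split z z∈
      ...   | inj₁ (inj₁ refl) = contradiction az E-irrefl
      ...   | inj₁ (inj₂ eq)   = inj₂ (inj₁ eq)
      ...   | inj₂ z∈₀         = inj₂ (inj₂ (inj₂ (unvisited βs z∈₀ az)))
        where
        unvisited : Arms b a (v ∷ R) W₀ W₁ → ∀ {z} → proj₁ z ∈ W₀ → E a z → proj₁ z ∈ W₁
        unvisited (none _)     z∈₀ _ = z∈₀
        unvisited (back _ _ _) z∈₀ _ = z∈₀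
        unvisited (kid κ _) {z} z∈₀ az with proj₁ z ∈? W₁
        ... | yes z∈₁ = z∈₁
        ... | no  z∉₁ = contradiction (exits κ (z∈₀ , z∉₁) (E-sym az) here) (<⇒≱ (low-pop refl κ))

      -- Each edge of H at `e` attaches to `a` or to `b`; besides `v`, only the arms of these two
      -- contribute neighbours.
      small : ∀ {W₁} → Arms b a (v ∷ R) W₀ W₁ → ∀ q →
              (∀ {z} → E a z → z ∈ R ⊎ proj₁ z ∈ W₁ → proj₁ z ≡ q) →
              (∀ {z} → E b z → z ∈ v ∷ R ⊎ proj₁ z ∈ W₀ → proj₁ z ≡ q) → Found W
      small βs q onlyᵃ onlyᵇ = e , e∈ , (proj₁ v , ev) , proj₁ v , q , nbr
        where
        nbr≢ : ∀ {f} → hadj e f ≡ true → f ≢ e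
        nbr≢ h refl = hirr h
        nbr : ∀ f → hadj e f ≡ true → f ≡ proj₁ v ⊎ f ≡ q
        nbr f h with port e f Bool.≟ σ
        nbr f h | yes p with join h p refl
        ... | af with other-a βs {f , port f e} af
        ...   | inj₁ refl         = inj₁ refl
        ...   | inj₂ (inj₁ eq)    = contradiction (cong proj₁ eq) (nbr≢ h)
        ...   | inj₂ (inj₂ other) = inj₂ (onlyᵃ af other)
        nbr f h | no ¬p with join h (Bool.¬-not ¬p) refl
        ... | bf with other-b {f , port f e} bf
        ...   | inj₁ eq    = contradiction (cong proj₁ eq) (nbr≢ h)
        ...   | inj₂ other = inj₂ (onlyᵇ bf other)

      b-back-at : ∀ {d t} → At (v ∷ R) d t → E b t → At R d t
      b-back-at here       bt = contradiction refl (b-exit≢ bt)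
      b-back-at (there at) _  = at

      module _ {W₂ : List (Fin m)} (W₂⊆ : W₂ ⊆ W₀) where

        a∈Vis : Visited W W₂ a
        a∈Vis = e∈ , e∉W₀ ∘ W₂⊆

        b∈Vis : Visited W W₂ b
        b∈Vis = e∈ , e∉W₀ ∘ W₂⊆

        -- The branch of `a` is lifted to `v`, and `b` with its back edge to `t` becomes the new
        -- leaf. `first≤` and `inner` ensure that no exit is farther from the root than `t`.
        extend : ∀ {Vis t d} → E b t → At R d t → (∀ {z} → E b z → z ≡ a ⊎ z ≡ t) →
                 (α : Branch a (v ∷ R) Vis) → (∀ {z} → Vis z → Visited W W₂ z) →
                 low α ≤ d → high α < d →
                 Reach (λ z → (Visited W W₂ z × z ≢ b) ⊎ z ≡ exit α) (first α) (exit α) →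
                 (∀ {z} → E a z → z ≡ v ⊎ z ≡ b ⊎ z ≡ first α) →
                 (∀ {c} → At (v ∷ R) c (first α) → c ≤ d) →
                 (∀ {z z′ c} → Visited W W₂ z → z ≢ a → z ≢ b → E z z′ → At (v ∷ R) c z′ → c ≤ d) →
                 Kid v R (Visited W W₂)
        extend {Vis} {t} {d} bt t-at onlyᵇ α sub low≤ high< around′ onlyᵃ first≤ inner = record
          { branch     = enlarge (lift stᵃ α (<-trans high< (At-< t-at)) (≤-<-trans low≤ (At-< t-at)))
                           [ sub , (λ { refl → a∈Vis }) ]′ (λ (z∈W , _) z∈ → sep z∈ z∈W) low≤
          ; leaf       = b
          ; leaf′      = t
          ; first∈     = a∈Vis
          ; leaf∈      = b∈Vis
          ; first-leaf = ab
          ; leaf-link  = bt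
          ; leaf′-at   = t-at
          ; leaf′≢     = b-exit≢ bt
          ; high<low   = high<
          ; around     = step (inj₁ (a∈Vis , b≢a ∘ sym)) (link α) around′
          ; exits      = exits′
          ; entry      = entry′
          }
          where
          exits′ : ∀ {z z′ c} → Visited W W₂ z → E z z′ → At R c z′ → c ≤ d
          exits′ {z} vis zz′ at with z ≟ a | z ≟ b
          ... | no z≢a | no z≢b = inner vis z≢a z≢b zz′ (there at)
          ... | yes refl | _ with onlyᵃ zz′
          ...   | inj₁ refl        = contradiction (At⇒∈ at) (top-∉ st)
          ...   | inj₂ (inj₁ refl) = contradiction (there (At⇒∈ at)) mate∉
          ...   | inj₂ (inj₂ refl) = first≤ (there at)
          exits′ {z} vis zz′ at | no _ | yes refl with onlyᵇ zz′
          ...   | inj₁ refl = contradiction (there (At⇒∈ at)) mate∉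
          ...   | inj₂ refl = ≤-reflexive (At-injective (unique (pop st)) at t-at)
          entry′ : ∀ {z} → Visited W W₂ z → E z v → z ≡ a
          entry′ {z} vis zv with z ≟ a | z ≟ b
          ... | yes eq | _       = eq
          ... | no _   | yes refl = contradiction refl (b-exit≢ zv)
          ... | no z≢a | no z≢b  = contradiction (inner vis z≢a z≢b zv here) (<⇒≱ (At-< t-at))

        visited-back : W₂ ≡ W₀ → ∀ {z} → Visited W W₂ z → z ≢ a → z ≢ b → ⊥
        visited-back refl {z} (z∈ , z∉) z≢a z≢b with split z z∈
        ... | inj₁ (inj₁ eq) = z≢a eq
        ... | inj₁ (inj₂ eq) = z≢b eq
        ... | inj₂ z∈₀       = z∉ z∈₀

      -- If an arm is empty, `e` has at most two neighbours in H. A kid of `b`, lifted to `a`,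
      -- clashes with any arm of `a`. There remains a back edge at `b` beside a back edge or a kid
      -- at `a`, where `extend` applies.
      combine : ∀ {W₁ W₂} → W₁ ⊆ W₀ → W₂ ⊆ W₁ →
                Arms b a (v ∷ R) W₀ W₁ → Arms a v R W₁ W₂ → Found W ⊎ Kid v R (Visited W W₂)
      combine _ _ βs@(none ¬b) (none ¬a) =
        -- With both arms empty any value serves as second neighbour; `e` is a filler.
        inj₁ (small βs e (λ az → ⊥-elim ∘ ¬a az) (λ bz → ⊥-elim ∘ ¬b bz))
      combine _ _ βs@(none ¬b) (back _ _ onlyᵃ) =
        inj₁ (small βs _ (λ az → cong proj₁ ∘ onlyᵃ az) (λ bz → ⊥-elim ∘ ¬b bz))
      combine _ _ βs@(none ¬b) (kid _ onlyᵃ) =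
        inj₁ (small βs _ (λ az → cong proj₁ ∘ onlyᵃ az) (λ bz → ⊥-elim ∘ ¬b bz))
      combine _ _ βs@(back _ _ onlyᵇ) (none ¬a) =
        inj₁ (small βs _ (λ az → ⊥-elim ∘ ¬a az) (λ bz → cong proj₁ ∘ onlyᵇ bz))
      combine _ _ βs@(kid _ onlyᵇ) (none ¬a) =
        inj₁ (small βs _ (λ az → ⊥-elim ∘ ¬a az) (λ bz → cong proj₁ ∘ onlyᵇ bz))
      combine _ _ (kid κ _) (back s-at as _) = ⊥-elim (two-branches theta stᵃ
        (lift stᵇ (branch κ) (<-trans (high<low κ) (low-pop refl κ)) (low-pop refl κ))
        (back-edge theta stᵃ as s-at) (λ _ ())
        (λ { refl → mate∉ (there (At⇒∈ s-at)) }))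
      combine W₁⊆ _ (kid κ _) (kid κ′ _) = ⊥-elim (two-branches theta stᵃ
        (lift stᵇ (branch κ) (<-trans (high<low κ) (low-pop refl κ)) (low-pop refl κ))
        (branch κ′)
        (λ { (inj₁ (_ , z∉₁)) (z∈₁ , _) → z∉₁ z∈₁ ; (inj₂ refl) (z∈₁ , _) → e∉W₀ (W₁⊆ z∈₁) })
        (λ eq → e∉W₀ (W₁⊆ (subst (λ z → proj₁ z ∈ _) (sym eq) (proj₁ (first∈ κ′))))))
      combine _ W₂⊆ βs@(back {d} {t} t-at′ bt onlyᵇ) (back {h} {s} s-at as onlyᵃ) =
        inj₂ (extend W₂⊆ bt (b-back-at t-at′ bt)
          (λ bz → [ inj₁ , inj₂ ∘ onlyᵇ bz ]′ (other-b bz))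
          -- Closing the cycle through `b` and `t` rather than through the parent `v` lowers the
          -- bound from the height of `v` to `d`, as `lift` requires.
          (edge-branch theta {Vis = _≡ b} {l = d} stᵃ (λ { refl → b∉ }) as (there s-at) ab b≢s
            (step (inj₁ refl) bt (weaken inj₂ (descend (linked st) (there s-at) t-at′ (<⇒≤ h<d)))))
          (λ { refl → b∈Vis W₂⊆ }) ≤-refl h<d (stop (inj₂ refl))
          (λ az → [ inj₁ , inj₂ ∘ [ inj₁ , inj₂ ∘ onlyᵃ az ]′ ]′ (other-a βs az))
          (λ at → <⇒≤ (subst (_< d) (At-injective (unique st) (there s-at) at) h<d))
          (λ vis z≢a z≢b → ⊥-elim (visited-back W₂⊆ refl vis z≢a z≢b)))
        where
        b≢s : b ≢ s
        b≢s refl = mate∉ (there (At⇒∈ s-at))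
        h<d : h < d
        -- Otherwise `b`, `t` and the stack from `t` up to `s` give a second connection that makes
        -- `a s` a chord.
        h<d = ≰⇒> λ d≤h →
          dominant (back-edge theta stᵃ as s-at) {S = λ z → z ≡ b ⊎ Segment (v ∷ R) d h z} ab b≢s
            (step (inj₁ refl) bt (weaken inj₂ (reverse (descend (linked st) t-at′ (there s-at) d≤h))))
            (λ { (inj₁ a≡b) → b≢a (sym a≡b) ; (inj₂ (_ , at , _)) → mate∉ (At⇒∈ at) })
            (λ _ ())
            (λ { (inj₁ refl) at _ _ → mate∉ (At⇒∈ at)
               ; (inj₂ (_ , at′ , _ , c≤h)) at h<c _ →
                   <⇒≱ h<c (subst (_≤ h) (At-injective (unique st) at′ at) c≤h) })
      combine _ W₂⊆ βs@(back {d} {t} t-at′ bt onlyᵇ) (kid κ onlyᵃ) =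
        inj₂ (extend W₂⊆ bt (b-back-at t-at′ bt)
          (λ bz → [ inj₁ , inj₂ ∘ onlyᵇ bz ]′ (other-b bz))
          (branch κ) (λ (z∈ , z∉) → W₀⊆ z∈ , z∉) low≤d (<-≤-trans (high<low κ) low≤d)
          (weaken [ (λ ((z∈ , z∉) , _) → inj₁ ((W₀⊆ z∈ , z∉) , λ { refl → e∉W₀ z∈ })) , inj₂ ]′ (around κ))
          (λ az → [ inj₁ , inj₂ ∘ [ inj₁ , inj₂ ∘ onlyᵃ az ]′ ]′ (other-a βs az))
          (λ at → contradiction (there (At⇒∈ at)) (fresh (branch κ) (first∈ κ)))
          inner)
        where
        low≤d : low (branch κ) ≤ d
        low≤d = low-exit stᵃ κ ab bt t-at′ b∉ (e∉W₀ ∘ proj₁)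
        inner : ∀ {z z′ c} → Visited W _ z → z ≢ a → z ≢ b → E z z′ → At (v ∷ R) c z′ → c ≤ d
        inner {z} (z∈ , z∉) z≢a z≢b zz′ at with split z z∈
        ... | inj₁ (inj₁ eq) = contradiction eq z≢a
        ... | inj₁ (inj₂ eq) = contradiction eq z≢b
        ... | inj₂ z∈₀       = ≤-trans (exits κ (z∈₀ , z∉) zz′ at) low≤d

    -- Induction on a bound for the number of unexplored pairs, which drops when `e` is removed. The
    -- arm of `b` is explored first, that of `a` in what remains.
    explore : ∀ k → Explorer k
    explore zero {W = _ ∷ _} () _ _ (here _)
    explore zero {W = _ ∷ _} () _ _ (there _)
    explore (suc k) len st sep e∈ clo va = first-arm (arms (explore k) len₀ stᵇ sepᵇ cloᵇ)
      where
      open Pair st sep e∈ clo va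
      len₀ = m<1+n⇒m≤n (<-≤-trans (∖-shorter e∈) len)
      first-arm : Outcome W₀ _ (Arms b a _ W₀) → Outcome _ _ _
      first-arm (inj₁ found) = inj₁ (found-⊆ W₀⊆ found)
      first-arm (inj₂ (W₁ , W₁⊆ , len₁ , clo₁ , βs))
        with arms (explore k) (≤-trans len₁ len₀) stᵃ (λ z∈ → sepᵃ z∈ ∘ W₁⊆) clo₁
      ... | inj₁ found = inj₁ (found-⊆ (W₀⊆ ∘ W₁⊆) found)
      ... | inj₂ (W₂ , W₂⊆ , len₂ , clo₂ , αs) with combine W₁⊆ W₂⊆ βs αs
      ...   | inj₁ found = inj₁ found
      ...   | inj₂ κ = inj₂ (W₂ , W₀⊆ ∘ W₁⊆ ∘ W₂⊆ ,
                             ≤-trans len₂ (≤-trans len₁ (<⇒≤ (∖-shorter e∈))) , clo₂ , κ)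

    small-besides : ∀ r f → hadj r f ≡ true → ∃[ g ] g ≢ r × Small g
    small-besides r f rf =
      [ (λ (g , g∈ , small) → g , (λ { refl → r∉ g∈ }) , small)
      -- Below the top of `root` there is a single vertex, so `low` would be `0` and `high` could
      -- not be smaller.
      , (λ (_ , _ , _ , _ , κ) →
           contradiction (<-≤-trans (high<low κ) (m<1+n⇒m≤n (At-< (leaf′-at κ)))) n≮0) ]′
      (explore (length W) ≤-refl st sep (∈W λ { refl → hirr rf }) clo (join rf refl refl))
      where
      root : List V
      root = (r , port r f) ∷ (r , not (port r f)) ∷ []
      W : List (Fin m)
      W = allFin m ∖ r
      ∈W : ∀ {g} → g ≢ r → g ∈ W
      ∈W = ∈-∖ (∈-allFin _)
      r∉ : r ∉ W
      r∉ = ∉-∖ (allFin m)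
      st : Stack root
      st = stack (mate refl ∷ [-]) (((λ eq → Bool.not-¬ refl (cong proj₂ eq)) ∷ []) ∷ [] ∷ [])
      sep : Separate root W
      sep (here refl)         = r∉
      sep (there (here refl)) = r∉
      ∈root : ∀ τ → (r , τ) ∈ root
      ∈root τ with τ Bool.≟ port r f
      ... | yes refl = here refl
      ... | no τ≢    = there (here (cong (r ,_) (Bool.¬-not τ≢)))
      clo : Closed W root
      clo {z = g , τ} _ _ with g Fin.≟ r
      ... | yes refl = inj₁ (∈root τ)
      ... | no g≢r   = inj₂ (∈W g≢r)

-- Degree bounds by counting

count-none : ∀ {A : Set} (p : A → Bool) xs → (∀ {z} → z ∈ xs → p z ≢ true) →
             sum (map (λ z → if p z then 1 else 0) xs) ≡ 0
count-none p []       _     = refl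
count-none p (x ∷ xs) never with p x in eq
... | true  = contradiction eq (never (here refl))
... | false = count-none p xs (never ∘ there)

count-≤1 : ∀ {A : Set} (p : A → Bool) {xs} → Unique xs → ∀ {a} →
           (∀ {z} → z ∈ xs → p z ≡ true → z ≡ a) →
           sum (map (λ z → if p z then 1 else 0) xs) ≤ 1
count-≤1 p []      _    = z≤n
count-≤1 p {x ∷ xs} (x∉ ∷ u) only with p x in eq
... | false = count-≤1 p u (only ∘ there)
... | true  = s≤s (≤-reflexive (count-none p xs λ z∈ pz →
                All.lookup x∉ z∈ (trans (only (here refl) eq) (sym (only (there z∈) pz)))))

count-≤2 : ∀ {A : Set} (p : A → Bool) {xs} → Unique xs → ∀ {a b} →
           (∀ {z} → z ∈ xs → p z ≡ true → z ≡ a ⊎ z ≡ b) →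
           sum (map (λ z → if p z then 1 else 0) xs) ≤ 2
count-≤2 p []      _    = z≤n
count-≤2 p {x ∷ xs} (x∉ ∷ u) {a} {b} only with p x in eq
... | false = count-≤2 p u (only ∘ there)
... | true  with only (here refl) eq
...   | inj₁ refl = s≤s (count-≤1 p u λ z∈ pz →
                      [ (λ z≡a → contradiction (sym z≡a) (All.lookup x∉ z∈)) , id ]′ (only (there z∈) pz))
...   | inj₂ refl = s≤s (count-≤1 p u λ z∈ pz →
                      [ id , (λ z≡b → contradiction (sym z≡b) (All.lookup x∉ z∈)) ]′ (only (there z∈) pz))

-- Transfer to the given graph, matching and subgraph

module Reduction {n} (G : Graph n) (chordless : Chordless G) (M : Matching G) (H : SubgraphGM M) where

  sides : ∀ e f → Bool × Bool
  sides e f with hadj H e f Bool.≟ true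
  ... | yes h = let _ , a , b , _ = hsub H e f h in a , b
  -- A default for pairs that are not adjacent in H.
  ... | no _  = false , false

  sides-adj : ∀ e f → hadj H e f ≡ true →
              adj G (end M e (proj₁ (sides e f))) (end M f (proj₂ (sides e f))) ≡ true
  sides-adj e f h with hadj H e f Bool.≟ true
  ... | yes h′ = let _ , _ , _ , ab = hsub H e f h′ in ab
  ... | no ¬h  = contradiction h ¬h

  -- hsub may give different edges of G for (e , f) and (f , e); the one with e < f is kept.
  port : Fin (size M) → Fin (size M) → Bool
  port e f with e Fin.<? f
  ... | yes _ = proj₁ (sides e f)
  ... | no _  = proj₂ (sides f e)

  irr : ∀ {e} → hadj H e e ≢ true
  irr h = proj₁ (hsub H _ _ h) refl

  port-adj : ∀ {e f} → hadj H e f ≡ true → adj G (end M e (port e f)) (end M f (port f e)) ≡ true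
  port-adj {e} {f} h with e Fin.<? f | f Fin.<? e
  ... | yes e<f | yes f<e = contradiction f<e (<-asym e<f)
  ... | yes _   | no _    = sides-adj e f h
  ... | no _    | yes _   = trans (adj-sym G _ _) (sides-adj f e (trans (hsym H f e) h))
  ... | no e≮f  | no f≮e  with Fin.<-cmp e f
  ...   | tri< e<f _ _ = contradiction e<f e≮f
  ...   | tri> _ _ f<e = contradiction f<e f≮e
  ...   | tri≈ _ refl _ = contradiction h irr

  open Ports (hadj H) (hsym H) irr port

  φ : V → Fin n
  φ (e , σ) = end M e σ

  φ-adj : ∀ {x y} → E x y → adj G (φ x) (φ y) ≡ true
  φ-adj (mate {e} {false} refl) = isEdge M e
  φ-adj (mate {e} {true} refl)  = trans (adj-sym G _ _) (isEdge M e)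
  φ-adj (join h refl refl)      = port-adj h

  φ-injective : ∀ {x y} → φ x ≡ φ y → x ≡ y
  φ-injective {e , σ} {f , τ} eq with disjoint M e f σ τ eq
  ... | refl with τ Bool.≟ σ
  ...   | yes refl = refl
  -- Equal ends of one matching edge would make that edge a loop.
  ...   | no τ≢σ   = contradiction
            (trans (sym (irrefl G _)) (trans (cong (adj G _) eq) (φ-adj (mate {e} (Bool.¬-not τ≢σ))))) λ ()

  open Search (thetaFree G chordless φ φ-injective φ-adj) public

  Small⇒degree : ∀ {g} → Small g → inH H g ≡ true × degH H g ≤ 2
  Small⇒degree {g} ((f , h) , _ , _ , only) =
    hvert H g f h , count-≤2 (hadj H g) (Unique.allFin⁺ _) (λ _ → only _)

theorem4 : ∀ {n} (G : Graph n) → Chordless G → (M : Matching G) → (H : SubgraphGM M)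
    → (∃[ x ] ∃[ y ] (x ≢ y × inH H x ≡ true × inH H y ≡ true))
    → ∃[ u ] ∃[ v ] (u ≢ v × inH H u ≡ true × inH H v ≡ true
    × degH H u ≤ 2 × degH H v ≤ 2)
theorem4 G chordless M H (x , y , x≢y , x∈ , y∈)
  with Fin.any? (λ e → Fin.any? (λ f → hadj H e f Bool.≟ true))
... | no edgeless = x , y , x≢y , x∈ , y∈ , isolated x , isolated y
  where
  isolated : ∀ e → degH H e ≤ 2
  isolated e = ≤-trans (≤-reflexive (count-none (hadj H e) (allFin _) λ _ h → edgeless (e , _ , h))) z≤n
... | yes (e , f , h) =
  let open Reduction G chordless M H
      u , _   , small-u@((u′ , uu′) , _) = small-besides e f h
      -- The second search is rooted at `u` itself, along the neighbour recorded in `small-u`, so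
      -- its result differs from `u`.
      v , v≢u , small-v                  = small-besides u u′ uu′
      u∈ , du = Small⇒degree small-u
      v∈ , dv = Small⇒degree small-v
  in u , v , v≢u ∘ sym , u∈ , v∈ , du , dv
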